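{- The sequent calculus $\mathsf{BDFNL}$ is a conservative extension of $\mathbf{S}_{\mathbb{BDI}}$; that is, for every $\mathcal{L}_{\mathrm{SI}}$-sequent $\phi\vdash\psi$, $\phi\vdash\psi$ is derivable in $\mathbf{S}_{\mathbb{BDI}}$ if and only if it is derivable in $\mathsf{BDFNL}$.
   Context: $\mathcal{L}_{\mathrm{SI}}$-formulas are built from propositional variables and $\top,\bot$ using $\wedge,\vee,\to$. $\mathcal{L}_{\mathrm{LC}}$-formulas are built from propositional variables and $\top,\bot$ using $\wedge,\vee,\to,\bullet,\leftarrow$. A sequent is an expression $\phi\vdash\psi$ with $\phi,\psi$ formulas. $\mathbf{S}_{\mathbb{BDI}}$ has the following axioms and rules for $\mathcal{L}_{\mathrm{SI}}$-formulas. Axioms: $\phi\vdash\phi$; $\phi\wedge(\psi\vee\gamma)\vdash(\phi\wedge\psi)\vee(\phi\wedge\gamma)$; $\phi\vdash\top$; $\bot\vdash\phi$; $\top\vdash\phi\to\top$; $\top\vdash\bot\to\phi$; $(\phi\to\psi)\wedge(\phi\to\gamma)\vdash\phi\to(\psi\wedge\gamma)$; $(\phi\to\gamma)\wedge(\psi\to\gamma)\vdash(\phi\vee\psi)\to\gamma$. Rules: from $\phi\vdash\psi$ infer $\chi\to\phi\vdash\chi\to\psi$; from $\phi\vdash\psi$ infer $\psi\to\chi\vdash\phi\to\chi$; from $\phi_i\vdash\psi$ infer $\phi_1\wedge\phi_2\vdash\psi$ ($i=1,2$); from $\gamma\vdash\phi$ and $\gamma\vdash\psi$ infer $\gamma\vdash\phi\wedge\psi$;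 from $\phi\vdash\chi$ and $\psi\vdash\chi$ infer $\phi\vee\psi\vdash\chi$; from $\psi\vdash\phi_i$ infer $\psi\vdash\phi_1\vee\phi_2$ ($i=1,2$); from $\phi\vdash\psi$ and $\psi\vdash\gamma$ infer $\phi\vdash\gamma$. $\mathsf{BDFNL}$ has the following axioms and rules for $\mathcal{L}_{\mathrm{LC}}$-formulas. Axioms: $\phi\vdash\phi$; $\phi\vdash\top$; $\bot\vdash\phi$; $\phi\wedge(\psi\vee\gamma)\vdash(\phi\wedge\psi)\vee(\phi\wedge\gamma)$. Rules: the same four rule schemes for $\wedge$ and $\vee$ and the cut rule as in $\mathbf{S}_{\mathbb{BDI}}$, together with the residuation rules: $\phi\bullet\psi\vdash\gamma$ and $\psi\vdash\phi\to\gamma$ can be inferred from each other; $\phi\bullet\psi\vdash\gamma$ and $\phi\vdash\gamma\leftarrow\psi$ can be inferred from each other. -}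

module Defs where

infixr 7 _∧_
infixr 6 _∨_
infixr 5 _⇒_
infixl 5 _⇐_
infixl 8 _•_
infix  3 _⊢SI_ _⊢LC_

-- Formulas over an arbitrary set of propositional variables. The object-level
-- connectives → and ← are written ⇒ and ⇐, since the arrows are reserved.

data FormSI (Var : Set) : Set where
  var         : Var → FormSI Var
  ⊤ ⊥         : FormSI Var
  _∧_ _∨_ _⇒_ : FormSI Var → FormSI Var → FormSI Var

data FormLC (Var : Set) : Set where
  var                 : Var → FormLC Var
  ⊤ ⊥                 : FormLC Var
  _∧_ _∨_ _⇒_ _•_ _⇐_ : FormLC Var → FormLC Var → FormLC Var

-- The inclusion of the SI-language in the LC-language.
embed : {Var : Set} → FormSI Var → FormLC Var
embed (var p) = var p
embed ⊤       = ⊤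
embed ⊥       = ⊥
embed (φ ∧ ψ) = embed φ ∧ embed ψ
embed (φ ∨ ψ) = embed φ ∨ embed ψ
embed (φ ⇒ ψ) = embed φ ⇒ embed ψ

-- Elements of φ ⊢SI ψ are the derivations of the sequent φ ⊢ ψ in the
-- calculus S_BDI.
data _⊢SI_ {Var : Set} : FormSI Var → FormSI Var → Set where
  ax      : ∀ {φ} → φ ⊢SI φ
  distrib : ∀ {φ ψ γ} → φ ∧ (ψ ∨ γ) ⊢SI (φ ∧ ψ) ∨ (φ ∧ γ)
  ⊤-ax    : ∀ {φ} → φ ⊢SI ⊤
  ⊥-ax    : ∀ {φ} → ⊥ ⊢SI φ
  ⇒-⊤     : ∀ {φ} → ⊤ ⊢SI φ ⇒ ⊤
  ⊥-⇒     : ∀ {φ} → ⊤ ⊢SI ⊥ ⇒ φ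
  ⇒-∧     : ∀ {φ ψ γ} → (φ ⇒ ψ) ∧ (φ ⇒ γ) ⊢SI φ ⇒ (ψ ∧ γ)
  ∨-⇒     : ∀ {φ ψ γ} → (φ ⇒ γ) ∧ (ψ ⇒ γ) ⊢SI (φ ∨ ψ) ⇒ γ
  ⇒-monoʳ : ∀ {φ ψ χ} → φ ⊢SI ψ → χ ⇒ φ ⊢SI χ ⇒ ψ
  ⇒-antiˡ : ∀ {φ ψ χ} → φ ⊢SI ψ → ψ ⇒ χ ⊢SI φ ⇒ χ
  ∧-l₁    : ∀ {φ₁ φ₂ ψ} → φ₁ ⊢SI ψ → φ₁ ∧ φ₂ ⊢SI ψ
  ∧-l₂    : ∀ {φ₁ φ₂ ψ} → φ₂ ⊢SI ψ → φ₁ ∧ φ₂ ⊢SI ψ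
  ∧-r     : ∀ {φ ψ γ} → γ ⊢SI φ → γ ⊢SI ψ → γ ⊢SI φ ∧ ψ
  ∨-l     : ∀ {φ ψ χ} → φ ⊢SI χ → ψ ⊢SI χ → φ ∨ ψ ⊢SI χ
  ∨-r₁    : ∀ {φ₁ φ₂ ψ} → ψ ⊢SI φ₁ → ψ ⊢SI φ₁ ∨ φ₂
  ∨-r₂    : ∀ {φ₁ φ₂ ψ} → ψ ⊢SI φ₂ → ψ ⊢SI φ₁ ∨ φ₂
  cut     : ∀ {φ ψ γ} → φ ⊢SI ψ → ψ ⊢SI γ → φ ⊢SI γ

-- Elements of φ ⊢LC ψ are the derivations of the sequent φ ⊢ ψ in the
-- calculus BDFNL.
data _⊢LC_ {Var : Set} : FormLC Var → FormLC Var → Set where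
  ax      : ∀ {φ} → φ ⊢LC φ
  ⊤-ax    : ∀ {φ} → φ ⊢LC ⊤
  ⊥-ax    : ∀ {φ} → ⊥ ⊢LC φ
  distrib : ∀ {φ ψ γ} → φ ∧ (ψ ∨ γ) ⊢LC (φ ∧ ψ) ∨ (φ ∧ γ)
  ∧-l₁    : ∀ {φ₁ φ₂ ψ} → φ₁ ⊢LC ψ → φ₁ ∧ φ₂ ⊢LC ψ
  ∧-l₂    : ∀ {φ₁ φ₂ ψ} → φ₂ ⊢LC ψ → φ₁ ∧ φ₂ ⊢LC ψ
  ∧-r     : ∀ {φ ψ γ} → γ ⊢LC φ → γ ⊢LC ψ → γ ⊢LC φ ∧ ψ
  ∨-l     : ∀ {φ ψ χ} → φ ⊢LC χ → ψ ⊢LC χ → φ ∨ ψ ⊢LC χ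
  ∨-r₁    : ∀ {φ₁ φ₂ ψ} → ψ ⊢LC φ₁ → ψ ⊢LC φ₁ ∨ φ₂
  ∨-r₂    : ∀ {φ₁ φ₂ ψ} → ψ ⊢LC φ₂ → ψ ⊢LC φ₁ ∨ φ₂
  cut     : ∀ {φ ψ γ} → φ ⊢LC ψ → ψ ⊢LC γ → φ ⊢LC γ
  res-⇒   : ∀ {φ ψ γ} → φ • ψ ⊢LC γ → ψ ⊢LC φ ⇒ γ
  res-⇒⁻¹ : ∀ {φ ψ γ} → ψ ⊢LC φ ⇒ γ → φ • ψ ⊢LC γ
  res-⇐   : ∀ {φ ψ γ} → φ • ψ ⊢LC γ → φ ⊢LC γ ⇐ ψ
  res-⇐⁻¹ : ∀ {φ ψ γ} → φ ⊢LC γ ⇐ ψ → φ • ψ ⊢LC γ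

{-# OPTIONS --safe #-}
module Submission where

-- BDFNL derives each axiom and rule of S_BDI, by residuation. Conversely, let
-- L be the preordered set of SI-formulas under derivability in S_BDI, and
-- consider its filters. The product
--
--     F ⊙ G  =  { c : there is a ∈ F with a ⇒ c ∈ G }
--
-- of two filters is a filter, because ⇒ preserves finite meets in its second
-- argument and is antitone in its first. Ordered by reverse inclusion, the
-- filters form a bounded distributive lattice with binary joins given by
-- intersection and with the improper filter as least element. The product
-- preserves finite joins in each argument: in the first because ⇒ turns finite
-- joins there into meets, in the second because ⇒ is antitone in its first
-- argument. Consequently the lattice of ideals of the filter lattice is
-- distributive and residuated, and BDFNL is sound in it. Sending a to the
-- ideal of all filters containing a embeds L and preserves ∧, ∨ and ⇒.
-- Conservativity follows by evaluating a BDFNL-derivable sequent φ ⊢ ψ at the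
-- principal filter of φ.
--
-- Ideals take the place of the usual prime filters, so the argument needs no
-- choice principle. It is written as a forcing relation between filters
-- and LC-formulas. The extension of every formula is an ideal (⊩-mono, ⊩-∩,
-- ⊩-improper), the relation is sound (⊩-sound), and on the SI-language forcing
-- is membership (⊩⇒∈, ∈⇒⊩).

open import Defs
open import Data.Product using (_×_; _,_; proj₁; proj₂; ∃-syntax)
open import Data.Unit using (tt) renaming (⊤ to Unit)
open import Function.Bundles using (_⇔_; mk⇔)
open import Level using (Lift; lift; 0ℓ) renaming (suc to lsuc)

private
  variable
    Var : Set

-- From S_BDI to BDFNL

•-monoˡ : {φ ψ χ : FormLC Var} → φ ⊢LC ψ → φ • χ ⊢LC ψ • χ
•-monoˡ d = res-⇐⁻¹ (cut d (res-⇐ ax))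

•-⊥ˡ : {φ χ : FormLC Var} → ⊥ • φ ⊢LC χ
•-⊥ˡ = res-⇐⁻¹ ⊥-ax

•-∨ˡ : {φ ψ χ γ : FormLC Var} → φ • χ ⊢LC γ → ψ • χ ⊢LC γ → (φ ∨ ψ) • χ ⊢LC γ
•-∨ˡ d e = res-⇐⁻¹ (∨-l (res-⇐ d) (res-⇐ e))

SI⇒LC : {φ ψ : FormSI Var} → φ ⊢SI ψ → embed φ ⊢LC embed ψ
SI⇒LC ax          = ax
SI⇒LC distrib     = distrib
SI⇒LC ⊤-ax        = ⊤-ax
SI⇒LC ⊥-ax        = ⊥-ax
SI⇒LC ⇒-⊤         = res-⇒ ⊤-ax
SI⇒LC ⊥-⇒         = res-⇒ •-⊥ˡ
SI⇒LC ⇒-∧         = res-⇒ (∧-r (res-⇒⁻¹ (∧-l₁ ax)) (res-⇒⁻¹ (∧-l₂ ax)))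
SI⇒LC ∨-⇒         = res-⇒ (•-∨ˡ (res-⇒⁻¹ (∧-l₁ ax)) (res-⇒⁻¹ (∧-l₂ ax)))
SI⇒LC (⇒-monoʳ d) = res-⇒ (cut (res-⇒⁻¹ ax) (SI⇒LC d))
SI⇒LC (⇒-antiˡ d) = res-⇒ (cut (•-monoˡ (SI⇒LC d)) (res-⇒⁻¹ ax))
SI⇒LC (∧-l₁ d)    = ∧-l₁ (SI⇒LC d)
SI⇒LC (∧-l₂ d)    = ∧-l₂ (SI⇒LC d)
SI⇒LC (∧-r d e)   = ∧-r (SI⇒LC d) (SI⇒LC e)
SI⇒LC (∨-l d e)   = ∨-l (SI⇒LC d) (SI⇒LC e)
SI⇒LC (∨-r₁ d)    = ∨-r₁ (SI⇒LC d)
SI⇒LC (∨-r₂ d)    = ∨-r₂ (SI⇒LC d)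
SI⇒LC (cut d e)   = cut (SI⇒LC d) (SI⇒LC e)

-- Order properties of the SI-formulas

∧-mono : {a b c d : FormSI Var} → a ⊢SI c → b ⊢SI d → a ∧ b ⊢SI c ∧ d
∧-mono p q = ∧-r (∧-l₁ p) (∧-l₂ q)

⇒-meet : {a b c d : FormSI Var} → (a ⇒ c) ∧ (b ⇒ d) ⊢SI (a ∧ b) ⇒ (c ∧ d)
⇒-meet = cut (∧-mono (⇒-antiˡ (∧-l₁ ax)) (⇒-antiˡ (∧-l₂ ax))) ⇒-∧

∧-interchange : {a b c d : FormSI Var} → (a ∧ b) ∧ (c ∧ d) ⊢SI (a ∧ c) ∧ (b ∧ d)
∧-interchange = ∧-r (∧-mono (∧-l₁ ax) (∧-l₁ ax)) (∧-mono (∧-l₂ ax) (∧-l₂ ax))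

∧-∨-elim : {a b c d e : FormSI Var} →
           a ∧ c ⊢SI e → b ∧ d ⊢SI e → (a ∧ b) ∧ (c ∨ d) ⊢SI e
∧-∨-elim p q = cut distrib (∨-l (cut (∧-mono (∧-l₁ ax) ax) p)
                                (cut (∧-mono (∧-l₂ ax) ax) q))

-- Filters

-- Filters of the preorder of SI-formulas. They are nonempty but not required to
-- be proper: the improper filter is the least element of the filter lattice.
record Filter (Var : Set) : Set₁ where
  field
    mem   : FormSI Var → Set
    ⊤-mem : mem ⊤
    up    : ∀ {a b} → a ⊢SI b → mem a → mem b
    meet  : ∀ {a b} → mem a → mem b → mem (a ∧ b)

open Filter

infix 4 _∈_ _⊆_

_∈_ : FormSI Var → Filter Var → Set
a ∈ F = mem F a

_⊆_ : Filter Var → Filter Var → Set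
F ⊆ G = ∀ {a} → a ∈ F → a ∈ G

improper : Filter Var
improper .mem _    = Unit
improper .⊤-mem    = tt
improper .up _ _   = tt
improper .meet _ _ = tt

-- The principal filter of a formula.
↑ : FormSI Var → Filter Var
↑ a .mem b      = a ⊢SI b
↑ a .⊤-mem      = ⊤-ax
↑ a .up d e     = cut e d
↑ a .meet d e   = ∧-r d e

infixr 7 _∩_
infixr 6 _⊔_
infixl 8 _⊙_

_∩_ : Filter Var → Filter Var → Filter Var
(F ∩ G) .mem a                    = a ∈ F × a ∈ G
(F ∩ G) .⊤-mem                    = ⊤-mem F , ⊤-mem G
(F ∩ G) .up d (p , q)             = up F d p , up G d q
(F ∩ G) .meet (p , q) (p′ , q′)   = meet F p p′ , meet G q q′

-- The filter generated by the union of two filters, which is their meet under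
-- reverse inclusion.
_⊔_ : Filter Var → Filter Var → Filter Var
(F ⊔ G) .mem c = ∃[ a ] ∃[ b ] (a ∈ F × b ∈ G × a ∧ b ⊢SI c)
(F ⊔ G) .⊤-mem = ⊤ , ⊤ , ⊤-mem F , ⊤-mem G , ⊤-ax
(F ⊔ G) .up d (a , b , p , q , e) = a , b , p , q , cut e d
(F ⊔ G) .meet (a , b , p , q , e) (a′ , b′ , p′ , q′ , e′) =
  a ∧ a′ , b ∧ b′ , meet F p p′ , meet G q q′ , cut ∧-interchange (∧-mono e e′)

⊔-inˡ : (F G : Filter Var) → F ⊆ F ⊔ G
⊔-inˡ F G {a} p = a , ⊤ , p , ⊤-mem G , ∧-l₁ ax

⊔-inʳ : (F G : Filter Var) → G ⊆ F ⊔ G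
⊔-inʳ F G {a} p = ⊤ , a , ⊤-mem F , p , ∧-l₂ ax

-- The distributive law of the filter lattice: in the reverse inclusion order, an
-- F below the join of G and H is below the join of its meets with G and with H.
⊔-distrib-∩ : (F G H : Filter Var) → G ∩ H ⊆ F → (F ⊔ G) ∩ (F ⊔ H) ⊆ F
⊔-distrib-∩ F G H s ((a , b , p , q , e) , (a′ , b′ , p′ , q′ , e′)) =
  up F (∧-∨-elim e e′)
       (meet F (meet F p p′) (s (up G (∨-r₁ ax) q , up H (∨-r₂ ax) q′)))

-- The product of filters. On principal filters, c ∈ ↑ a ⊙ ↑ b holds exactly when
-- b ⊢SI a ⇒ c, so ⊙ is residuated by ⇒ there.
_⊙_ : Filter Var → Filter Var → Filter Var
(F ⊙ G) .mem c = ∃[ a ] (a ∈ F × a ⇒ c ∈ G)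
(F ⊙ G) .⊤-mem = ⊤ , ⊤-mem F , up G ⇒-⊤ (⊤-mem G)
(F ⊙ G) .up d (a , p , q) = a , p , up G (⇒-monoʳ d) q
(F ⊙ G) .meet (a , p , q) (b , p′ , q′) =
  a ∧ b , meet F p p′ , up G ⇒-meet (meet G q q′)

⊙-mono : (F F′ G G′ : Filter Var) → F ⊆ F′ → G ⊆ G′ → F ⊙ G ⊆ F′ ⊙ G′
⊙-mono F F′ G G′ s t (a , p , q) = a , s p , t q

⊙-∩ˡ : (F F′ G : Filter Var) → (F ⊙ G) ∩ (F′ ⊙ G) ⊆ (F ∩ F′) ⊙ G
⊙-∩ˡ F F′ G ((a , p , q) , (b , p′ , q′)) =
  a ∨ b , (up F (∨-r₁ ax) p , up F′ (∨-r₂ ax) p′) , up G ∨-⇒ (meet G q q′)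

⊙-∩ʳ : (F G G′ : Filter Var) → (F ⊙ G) ∩ (F ⊙ G′) ⊆ F ⊙ (G ∩ G′)
⊙-∩ʳ F G G′ ((a , p , q) , (b , p′ , q′)) =
  a ∧ b , meet F p p′ ,
  (up G (⇒-antiˡ (∧-l₁ ax)) q , up G′ (⇒-antiˡ (∧-l₂ ax)) q′)

⊙-improperˡ : (G : Filter Var) → improper ⊆ improper ⊙ G
⊙-improperˡ G _ = ⊥ , tt , up G ⊥-⇒ (⊤-mem G)

⊙-improperʳ : (F : Filter Var) → improper ⊆ F ⊙ improper
⊙-improperʳ F _ = ⊤ , ⊤-mem F , tt

-- Forcing

infix 3 _⊩_

-- F ⊩ A says that F belongs to the ideal of filters interpreting A. The clauses
-- for ∨ and • give the join and the product in the lattice of ideals, those for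
-- ⇒ and ⇐ the two residuals of that product.
_⊩_ : Filter Var → FormLC Var → Set₁
F ⊩ var p = Lift (lsuc 0ℓ) (var p ∈ F)
F ⊩ ⊤     = Lift (lsuc 0ℓ) Unit
F ⊩ ⊥     = Lift (lsuc 0ℓ) (⊥ ∈ F)
F ⊩ A ∧ B = (F ⊩ A) × (F ⊩ B)
F ⊩ A ∨ B = ∃[ G ] ∃[ H ] ((G ⊩ A) × (H ⊩ B) × G ∩ H ⊆ F)
F ⊩ A • B = ∃[ G ] ∃[ H ] ((G ⊩ A) × (H ⊩ B) × G ⊙ H ⊆ F)
F ⊩ A ⇒ B = ∀ G → G ⊩ A → G ⊙ F ⊩ B
F ⊩ B ⇐ A = ∀ G → G ⊩ A → F ⊙ G ⊩ B

⊩-mono : (A : FormLC Var) (F G : Filter Var) → F ⊆ G → F ⊩ A → G ⊩ A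
⊩-mono (var p) F G s (lift x) = lift (s x)
⊩-mono ⊤       F G s _        = lift tt
⊩-mono ⊥       F G s (lift x) = lift (s x)
⊩-mono (A ∧ B) F G s (x , y)  = ⊩-mono A F G s x , ⊩-mono B F G s y
⊩-mono (A ∨ B) F G s (H , K , x , y , t) = H , K , x , y , λ z → s (t z)
⊩-mono (A • B) F G s (H , K , x , y , t) = H , K , x , y , λ z → s (t z)
⊩-mono (A ⇒ B) F G s f H x =
  ⊩-mono B (H ⊙ F) (H ⊙ G) (⊙-mono H H F G (λ z → z) s) (f H x)
⊩-mono (B ⇐ A) F G s f H x =
  ⊩-mono B (F ⊙ H) (G ⊙ H) (⊙-mono F G H H s (λ z → z)) (f H x)

⊩-∩ : (A : FormLC Var) (F G : Filter Var) → F ⊩ A → G ⊩ A → F ∩ G ⊩ A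
⊩-∩ (var p) F G (lift x) (lift y) = lift (x , y)
⊩-∩ ⊤       F G _ _               = lift tt
⊩-∩ ⊥       F G (lift x) (lift y) = lift (x , y)
⊩-∩ (A ∧ B) F G (x , y) (x′ , y′) = ⊩-∩ A F G x x′ , ⊩-∩ B F G y y′
⊩-∩ (A ∨ B) F G (H , K , x , y , t) (H′ , K′ , x′ , y′ , t′) =
  H ∩ H′ , K ∩ K′ , ⊩-∩ A H H′ x x′ , ⊩-∩ B K K′ y y′ ,
  λ { ((h , h′) , (k , k′)) → t (h , k) , t′ (h′ , k′) }
⊩-∩ (A • B) F G (H , K , x , y , t) (H′ , K′ , x′ , y′ , t′) =
  H ∩ H′ , K ∩ K′ , ⊩-∩ A H H′ x x′ , ⊩-∩ B K K′ y y′ ,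
  λ { (a , (h , h′) , (k , k′)) → t (a , h , k) , t′ (a , h′ , k′) }
⊩-∩ (A ⇒ B) F G f g H x =
  ⊩-mono B ((H ⊙ F) ∩ (H ⊙ G)) (H ⊙ (F ∩ G)) (⊙-∩ʳ H F G)
    (⊩-∩ B (H ⊙ F) (H ⊙ G) (f H x) (g H x))
⊩-∩ (B ⇐ A) F G f g H x =
  ⊩-mono B ((F ⊙ H) ∩ (G ⊙ H)) ((F ∩ G) ⊙ H) (⊙-∩ˡ F G H)
    (⊩-∩ B (F ⊙ H) (G ⊙ H) (f H x) (g H x))

⊩-improper : (A : FormLC Var) → improper ⊩ A
⊩-improper (var p) = lift tt
⊩-improper ⊤       = lift tt
⊩-improper ⊥       = lift tt
⊩-improper (A ∧ B) = ⊩-improper A , ⊩-improper B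
⊩-improper (A ∨ B) = improper , improper , ⊩-improper A , ⊩-improper B , λ _ → tt
⊩-improper (A • B) = improper , improper , ⊩-improper A , ⊩-improper B , λ _ → tt
⊩-improper (A ⇒ B) G _ =
  ⊩-mono B improper (G ⊙ improper) (λ {a} → ⊙-improperʳ G {a}) (⊩-improper B)
⊩-improper (B ⇐ A) G _ =
  ⊩-mono B improper (improper ⊙ G) (⊙-improperˡ G) (⊩-improper B)

⊩-sound : {A B : FormLC Var} → A ⊢LC B → (F : Filter Var) → F ⊩ A → F ⊩ B
⊩-sound ax F x = x
⊩-sound ⊤-ax F x = lift tt
⊩-sound (⊥-ax {A}) F (lift x) =
  ⊩-mono A improper F (λ _ → up F ⊥-ax x) (⊩-improper A)
⊩-sound (distrib {A} {B} {C}) F (x , G , H , y , z , s) =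
  F ⊔ G , F ⊔ H ,
  (⊩-mono A F (F ⊔ G) (⊔-inˡ F G) x , ⊩-mono B G (F ⊔ G) (⊔-inʳ F G) y) ,
  (⊩-mono A F (F ⊔ H) (⊔-inˡ F H) x , ⊩-mono C H (F ⊔ H) (⊔-inʳ F H) z) ,
  ⊔-distrib-∩ F G H s
⊩-sound (∧-l₁ d) F (x , _) = ⊩-sound d F x
⊩-sound (∧-l₂ d) F (_ , y) = ⊩-sound d F y
⊩-sound (∧-r d e) F x = ⊩-sound d F x , ⊩-sound e F x
⊩-sound (∨-l {χ = C} d e) F (G , H , x , y , s) =
  ⊩-mono C (G ∩ H) F s (⊩-∩ C G H (⊩-sound d G x) (⊩-sound e H y))
⊩-sound (∨-r₁ {φ₂ = B} d) F x = F , improper , ⊩-sound d F x , ⊩-improper B , proj₁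
⊩-sound (∨-r₂ {φ₁ = A} d) F x = improper , F , ⊩-improper A , ⊩-sound d F x , proj₂
⊩-sound (cut d e) F x = ⊩-sound e F (⊩-sound d F x)
⊩-sound (res-⇒ d) F y G x = ⊩-sound d (G ⊙ F) (G , F , x , y , λ z → z)
⊩-sound (res-⇒⁻¹ {γ = C} d) F (G , H , x , y , s) =
  ⊩-mono C (G ⊙ H) F s (⊩-sound d H y G x)
⊩-sound (res-⇐ d) F x G y = ⊩-sound d (F ⊙ G) (F , G , x , y , λ z → z)
⊩-sound (res-⇐⁻¹ {γ = C} d) F (G , H , x , y , s) =
  ⊩-mono C (G ⊙ H) F s (⊩-sound d G x H y)

-- Forcing of SI-formulas

mutual

  ⊩⇒∈ : (φ : FormSI Var) (F : Filter Var) → F ⊩ embed φ → φ ∈ F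
  ⊩⇒∈ (var p) F (lift x) = x
  ⊩⇒∈ ⊤       F _        = ⊤-mem F
  ⊩⇒∈ ⊥       F (lift x) = x
  ⊩⇒∈ (φ ∧ ψ) F (x , y)  = meet F (⊩⇒∈ φ F x) (⊩⇒∈ ψ F y)
  ⊩⇒∈ (φ ∨ ψ) F (G , H , x , y , s) =
    s (up G (∨-r₁ ax) (⊩⇒∈ φ G x) , up H (∨-r₂ ax) (⊩⇒∈ ψ H y))
  -- At the principal filter of φ, membership of ψ in the product gives a
  -- consequence a of φ with a ⇒ ψ ∈ F.
  ⊩⇒∈ (φ ⇒ ψ) F f with ⊩⇒∈ ψ (↑ φ ⊙ F) (f (↑ φ) (∈⇒⊩ φ (↑ φ) ax))
  ... | a , d , q = up F (⇒-antiˡ d) q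

  ∈⇒⊩ : (φ : FormSI Var) (F : Filter Var) → φ ∈ F → F ⊩ embed φ
  ∈⇒⊩ (var p) F x = lift x
  ∈⇒⊩ ⊤       F x = lift tt
  ∈⇒⊩ ⊥       F x = lift x
  ∈⇒⊩ (φ ∧ ψ) F x = ∈⇒⊩ φ F (up F (∧-l₁ ax) x) , ∈⇒⊩ ψ F (up F (∧-l₂ ax) x)
  ∈⇒⊩ (φ ∨ ψ) F x =
    ↑ φ , ↑ ψ , ∈⇒⊩ φ (↑ φ) ax , ∈⇒⊩ ψ (↑ ψ) ax , λ { (d , e) → up F (∨-l d e) x }
  ∈⇒⊩ (φ ⇒ ψ) F x G y = ∈⇒⊩ ψ (G ⊙ F) (φ , ⊩⇒∈ φ G y , x)

LC⇒SI : (φ ψ : FormSI Var) → embed φ ⊢LC embed ψ → φ ⊢SI ψ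
LC⇒SI φ ψ d = ⊩⇒∈ ψ (↑ φ) (⊩-sound d (↑ φ) (∈⇒⊩ φ (↑ φ) ax))

corollary1 : (Var : Set) (φ ψ : FormSI Var) → (φ ⊢SI ψ) ⇔ (embed φ ⊢LC embed ψ)
corollary1 Var φ ψ = mk⇔ SI⇒LC (LC⇒SI φ ψ)
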